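{- For every integer $n\ge 0$, $$e_2p_4(n+48)\equiv e_2p_4(n)\pmod 2,$$ $$e_2p_4(n+54)\equiv e_2p_4(n)\pmod 3,$$ $$e_2p_4(n+96)\equiv e_2p_4(n)\pmod 4.$$
   Context: A partition $\lambda=(\lambda_1,\dots,\lambda_\ell)$ of $n$ is a weakly decreasing sequence of positive integers with sum $n$; its length is $\ell$. For a partition $\lambda$ of length $\ell$, $e_2(\lambda)=\sum_{1\le i<k\le \ell}\lambda_i\lambda_k$. $\mathcal P(4,n)$ denotes the set of partitions of $n$ of length exactly $4$, and $e_2p_4(n)=\sum_{\lambda\in\mathcal P(4,n)}e_2(\lambda)$ (an empty sum is $0$). -}

module Defs where

open import Data.Fin.Base as Fin using (Fin)
import Data.Fin.Properties as Fin
open import Data.List.Base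
  using (List; []; _∷_; map; filter; length; lookup; upTo; allFin;
         cartesianProduct; cartesianProductWith)
open import Data.List.Membership.Propositional using (_∈_)
open import Data.List.Membership.Propositional.Properties
  using (∈-cartesianProductWith⁺; ∈-cartesianProductWith⁻;
         ∈-filter⁺; ∈-filter⁻; ∈-upTo⁺)
open import Data.List.Properties using (∷-injective)
open import Data.List.Relation.Unary.All as All using (All; []; _∷_)
open import Data.List.Relation.Unary.Any using (here)
open import Data.List.Relation.Unary.Linked using (Linked; linked?)
open import Data.List.Relation.Unary.Unique.Propositional using (Unique; []; _∷_)
import Data.List.Relation.Unary.Unique.Propositional.Properties as Unique
open import Data.Nat.Base using (ℕ; zero; suc; _*_; _≤_; _<_; _≥_; s≤s)
open import Data.Nat.ListAction using (sum)
open import Data.Nat.Properties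
  using (_≟_; _<?_; _≥?_; ≤-refl; ≤-trans; m≤m+n; m≤n+m)
open import Data.Product.Base using (_×_; _,_; proj₁; proj₂)
open import Function.Bundles using (_⇔_; mk⇔)
open import Relation.Binary.PropositionalEquality using (_≡_; refl; cong; subst)
open import Relation.Nullary.Decidable using (Dec; map′; _×-dec_)

infix 4 _⊢_ _⊢?_

record _⊢_ (xs : List ℕ) (n : ℕ) : Set where
  field
    decreasing : Linked _≥_ xs
    positive   : All (0 <_) xs
    total      : sum xs ≡ n

_⊢?_ : ∀ xs n → Dec (xs ⊢ n)
xs ⊢? n = map′
  (λ (d , p , t) → record { decreasing = d ; positive = p ; total = t })
  (λ q → _⊢_.decreasing q , _⊢_.positive q , _⊢_.total q)
  (linked? _≥?_ xs ×-dec All.all? (0 <?_) xs ×-dec sum xs ≟ n)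

words : ∀ {A : Set} → ℕ → List A → List (List A)
words zero    as = [] ∷ []
words (suc ℓ) as = cartesianProductWith _∷_ as (words ℓ as)

-- The parts of a partition of n are at most n, so searching the words over
-- {0, …, n} misses none; see ∈-𝒫 and 𝒫-unique below.
𝒫 : ℕ → ℕ → List (List ℕ)
𝒫 ℓ n = filter (_⊢? n) (words ℓ (upTo (suc n)))

e₂ : List ℕ → ℕ
e₂ xs = sum (map (λ (i , k) → lookup xs i * lookup xs k)
                 (filter (λ (i , k) → i Fin.<? k)
                         (cartesianProduct (allFin (length xs)) (allFin (length xs)))))

e₂p₄ : ℕ → ℕ
e₂p₄ n = sum (map e₂ (𝒫 4 n))

∈-words⁺ : ∀ {A : Set} {as : List A} xs → All (_∈ as) xs → xs ∈ words (length xs) as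
∈-words⁺ []       []       = here refl
∈-words⁺ (x ∷ xs) (p ∷ ps) = ∈-cartesianProductWith⁺ _∷_ p (∈-words⁺ xs ps)

∈-words⁻ : ∀ {A : Set} ℓ {as : List A} {xs} → xs ∈ words ℓ as → length xs ≡ ℓ
∈-words⁻ zero (here refl) = refl
∈-words⁻ (suc ℓ) {as} p
  with _ , _ , _ , q , refl ← ∈-cartesianProductWith⁻ _∷_ as (words ℓ as) p
  = cong suc (∈-words⁻ ℓ q)

words-unique : ∀ {A : Set} ℓ {as : List A} → Unique as → Unique (words ℓ as)
words-unique zero    u = [] ∷ []
words-unique (suc ℓ) u =
  Unique.cartesianProductWith⁺ _∷_ ∷-injective u (words-unique ℓ u)

parts≤sum : ∀ xs → All (_≤ sum xs) xs
parts≤sum []       = []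
parts≤sum (x ∷ xs) =
  m≤m+n x (sum xs) ∷ All.map (λ p → ≤-trans p (m≤n+m (sum xs) x)) (parts≤sum xs)

∈-𝒫 : ∀ {ℓ n xs} → xs ∈ 𝒫 ℓ n ⇔ (xs ⊢ n × length xs ≡ ℓ)
∈-𝒫 {ℓ} {n} {xs} = mk⇔ to from
  where
  to : xs ∈ 𝒫 ℓ n → xs ⊢ n × length xs ≡ ℓ
  to p with q , r ← ∈-filter⁻ (_⊢? n) {xs = words ℓ (upTo (suc n))} p
    = r , ∈-words⁻ ℓ q

  from : xs ⊢ n × length xs ≡ ℓ → xs ∈ 𝒫 ℓ n
  from (r , refl) = ∈-filter⁺ (_⊢? n) (∈-words⁺ xs (All.map (λ p → ∈-upTo⁺ (s≤s p)) bound)) r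
    where
    bound : All (_≤ n) xs
    bound = subst (λ m → All (_≤ m) xs) (_⊢_.total r) (parts≤sum xs)

𝒫-unique : ∀ ℓ n → Unique (𝒫 ℓ n)
𝒫-unique ℓ n = Unique.filter⁺ (_⊢? n) (words-unique ℓ (Unique.upTo⁺ (suc n)))

{-# OPTIONS --safe #-}
module Submission where

-- A partition of k + 1 + n into k + 1 parts either ends in 1, and deleting that
-- part leaves a partition of k + n into k parts, or has all parts at least 2,
-- and lowering each of them by 1 leaves a partition of n into k + 1 parts.
-- Hence u = number of partitions into k + 1 parts and u = sum of their e₂
-- both satisfy a recurrence u (k + 1 + n) = u n + g n, whose source g comes
-- from fewer parts, except for the term (k n + C(k+1,2)) · (number of partitions
-- of n into k + 1 parts) in the case of e₂.  If g has period T mod m, so does u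
-- as soon as u T, …, u (T + k) vanish mod m, which is a finite computation.
-- For m = 3 and four parts the exceptional coefficient 3 n + 6 vanishes, so it
-- does not matter that the number of partitions lacks the period 54.

open import Defs
open import Data.List.Base
  using (List; []; _∷_; _∷ʳ_; _++_; map; length; applyUpTo)
open import Data.List.Membership.Propositional using (_∈_)
open import Data.List.Membership.Propositional.Properties
  using (∈-++⁺ˡ; ∈-++⁺ʳ; ∈-++⁻; ∈-map⁺; ∈-map⁻)
open import Data.List.Membership.Propositional.Properties.WithK using (unique∧set⇒bag)
open import Data.List.Properties
  using (length-++; length-map; map-++; map-∘; map-injective; map-cong-local;
         ∷-injectiveʳ; ∷ʳ-injectiveˡ; applyUpTo-∷ʳ)
open import Data.List.Relation.Binary.BagAndSetEquality using (∼bag⇒↭)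
open import Data.List.Relation.Binary.Disjoint.Propositional using (Disjoint)
open import Data.List.Relation.Binary.Permutation.Propositional using (_↭_)
open import Data.List.Relation.Binary.Permutation.Propositional.Properties
  using (map⁺; ↭-length)
open import Data.List.Relation.Unary.All as All using (All; []; _∷_)
import Data.List.Relation.Unary.All.Properties as All
open import Data.List.Relation.Unary.Any using (here)
open import Data.List.Relation.Unary.Linked as Linked using (Linked; []; [-]; _∷_)
import Data.List.Relation.Unary.Linked.Properties as Linked
import Data.List.Relation.Unary.Unique.Propositional.Properties as Unique
open import Data.Nat
  using (ℕ; zero; suc; _+_; _*_; _∸_; _/_; _%_; _≤_; _<_; _≥_; z≤n; s≤s; s≤s⁻¹; NonZero; >-nonZero⁻¹)
open import Data.Nat.Combinatorics using (_C_; nC1≡n; nCk+nC[k+1]≡[n+1]C[k+1])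
open import Data.Nat.DivMod
open import Data.Nat.Divisibility using (∣-refl)
open import Data.Nat.Induction using (<-rec)
open import Data.Nat.ListAction using (sum)
open import Data.Nat.ListAction.Properties using (sum-++; sum-↭)
open import Data.Nat.Properties
open import Data.Nat.Tactic.RingSolver using (solve-∀)
open import Data.Product using (_×_; _,_; ∃; proj₁; proj₂)
open import Data.Sum using (_⊎_; inj₁; inj₂; [_,_])
open import Function.Base using (_∘_)
open import Function.Bundles using (mk⇔; Equivalence)
open import Relation.Binary.PropositionalEquality hiding ([_])
open import Relation.Nullary using (yes; no; ¬_; contradiction)
open import Relation.Nullary.Decidable using (True; toWitness)

-- Sums and lengths of lists.

sum-∷ʳ : ∀ xs x → sum (xs ∷ʳ x) ≡ x + sum xs
sum-∷ʳ xs x = trans (sum-++ xs (x ∷ [])) (trans (cong (sum xs +_) (+-identityʳ x)) (+-comm (sum xs) x))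

length-∷ʳ : ∀ {A : Set} (xs : List A) x → length (xs ∷ʳ x) ≡ suc (length xs)
length-∷ʳ xs x = trans (length-++ xs) (+-comm (length xs) 1)

sum-map-suc : ∀ xs → sum (map suc xs) ≡ length xs + sum xs
sum-map-suc []       = refl
sum-map-suc (x ∷ xs) = cong suc (trans (cong (x +_) (sum-map-suc xs)) (swap x (length xs) (sum xs)))
  where
  swap : ∀ a b c → a + (b + c) ≡ b + (a + c)
  swap = solve-∀

sum-map-+ : ∀ {A : Set} {f h : A → ℕ} {c} {xs} →
            All (λ x → h x ≡ f x + c) xs →
            sum (map h xs) ≡ sum (map f xs) + c * length xs
sum-map-+ {c = c} [] = sym (*-zeroʳ c)
sum-map-+ {f = f} {c = c} {x ∷ xs} (p ∷ ps) =
  trans (cong₂ _+_ p (sum-map-+ ps)) (regroup (f x) c (sum (map f xs)) (length xs))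
  where
  regroup : ∀ a b s l → (a + b) + (s + b * l) ≡ (a + s) + b * suc l
  regroup = solve-∀

-- Splitting partitions by whether the smallest part is 1.

Linked-∷ʳ1⁺ : ∀ {xs} → Linked _≥_ xs → All (0 <_) xs → Linked _≥_ (xs ∷ʳ 1)
Linked-∷ʳ1⁺ []      []       = [-]
Linked-∷ʳ1⁺ [-]     (p ∷ []) = p ∷ [-]
Linked-∷ʳ1⁺ (r ∷ l) (_ ∷ ps) = r ∷ Linked-∷ʳ1⁺ l ps

Linked-∷ʳ⁻ : ∀ xs {x} → Linked _≥_ (xs ∷ʳ x) → Linked _≥_ xs
Linked-∷ʳ⁻ []           _       = []
Linked-∷ʳ⁻ (x ∷ [])     _       = [-]
Linked-∷ʳ⁻ (x ∷ y ∷ xs) (r ∷ l) = r ∷ Linked-∷ʳ⁻ (y ∷ xs) l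

-- The last part is the smallest, so it alone decides the case: if it exceeds 1, so do all the
-- others.
unsnoc-1∨map-suc : ∀ {k} xs → Linked _≥_ xs → All (0 <_) xs → length xs ≡ suc k →
                   (∃ λ ys → xs ≡ ys ∷ʳ 1) ⊎
                   (∃ λ ys → xs ≡ map suc ys × All (0 <_) ys)
unsnoc-1∨map-suc (zero ∷ []) _ (() ∷ _) _
unsnoc-1∨map-suc (1 ∷ [])           _ _ _ = inj₁ ([] , refl)
unsnoc-1∨map-suc (suc (suc x) ∷ []) _ _ _ = inj₂ (suc x ∷ [] , refl , s≤s z≤n ∷ [])
unsnoc-1∨map-suc (suc x ∷ y ∷ xs) (r ∷ l) (p ∷ ps) _ with unsnoc-1∨map-suc (y ∷ xs) l ps refl
... | inj₁ (ys , eq) = inj₁ (suc x ∷ ys , cong (suc x ∷_) eq)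
... | inj₂ (z ∷ ys , refl , q ∷ qs) =
  -- From `0 < z` and `suc z ≤ suc x` it follows that `x` is positive.
  inj₂ (x ∷ z ∷ ys , refl , ≤-trans q (s≤s⁻¹ r) ∷ q ∷ qs)

-- A final 1 on the right would come from an entry 0 of `ys`. This keeps the two kinds of partition
-- disjoint.
∷ʳ1≢map-suc : ∀ xs {ys} → All (0 <_) ys → ¬ (xs ∷ʳ 1 ≡ map suc ys)
∷ʳ1≢map-suc []       {zero ∷ _}  (() ∷ _) _
∷ʳ1≢map-suc []       {suc _ ∷ _} _        ()
∷ʳ1≢map-suc (x ∷ xs) (_ ∷ ps) eq = ∷ʳ1≢map-suc xs ps (∷-injectiveʳ eq)

∷ʳ1-⊢⁺ : ∀ {xs n} → xs ⊢ n → (xs ∷ʳ 1) ⊢ suc n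
∷ʳ1-⊢⁺ {xs} q = record
  { decreasing = Linked-∷ʳ1⁺ (_⊢_.decreasing q) (_⊢_.positive q)
  ; positive   = All.∷ʳ⁺ (_⊢_.positive q) (s≤s z≤n)
  ; total      = trans (sum-∷ʳ xs 1) (cong suc (_⊢_.total q))
  }

∷ʳ1-⊢⁻ : ∀ {xs n} → (xs ∷ʳ 1) ⊢ suc n → xs ⊢ n
∷ʳ1-⊢⁻ {xs} q = record
  { decreasing = Linked-∷ʳ⁻ xs (_⊢_.decreasing q)
  ; positive   = proj₁ (All.∷ʳ⁻ (_⊢_.positive q))
  ; total      = suc-injective (trans (sym (sum-∷ʳ xs 1)) (_⊢_.total q))
  }

map-suc-⊢⁺ : ∀ {xs n} → xs ⊢ n → map suc xs ⊢ length xs + n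
map-suc-⊢⁺ {xs} q = record
  { decreasing = Linked.map⁺ (Linked.map s≤s (_⊢_.decreasing q))
  ; positive   = All.map⁺ (All.map (λ _ → s≤s z≤n) (_⊢_.positive q))
  ; total      = trans (sum-map-suc xs) (cong (length xs +_) (_⊢_.total q))
  }

map-suc-⊢⁻ : ∀ {xs n} → All (0 <_) xs → map suc xs ⊢ length xs + n → xs ⊢ n
map-suc-⊢⁻ {xs} p q = record
  { decreasing = Linked.map s≤s⁻¹ (Linked.map⁻ (_⊢_.decreasing q))
  ; positive   = p
  ; total      = +-cancelˡ-≡ (length xs) _ _ (trans (sym (sum-map-suc xs)) (_⊢_.total q))
  }

∈𝒫⁺ : ∀ {ℓ n xs} → xs ⊢ n → length xs ≡ ℓ → xs ∈ 𝒫 ℓ n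
∈𝒫⁺ q l = Equivalence.from ∈-𝒫 (q , l)

∈𝒫⁻ : ∀ {ℓ n xs} → xs ∈ 𝒫 ℓ n → xs ⊢ n × length xs ≡ ℓ
∈𝒫⁻ = Equivalence.to ∈-𝒫

-- Both sides are free of duplicates and have the same members, so they agree as multisets. A
-- permutation suffices, since only lengths and sums are taken later.
𝒫-step : ∀ k n → 𝒫 (suc k) (suc k + n) ↭
                 map (_∷ʳ 1) (𝒫 k (k + n)) ++ map (map suc) (𝒫 (suc k) n)
𝒫-step k n = ∼bag⇒↭ (unique∧set⇒bag
  (𝒫-unique (suc k) (suc k + n))
  (Unique.++⁺ (Unique.map⁺ (∷ʳ-injectiveˡ _ _) (𝒫-unique k (k + n)))
              (Unique.map⁺ (map-injective suc-injective) (𝒫-unique (suc k) n))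
              disjoint)
  (mk⇔ to ([ fromˡ , fromʳ ] ∘ ∈-++⁻ A)))
  where
  A = map (_∷ʳ 1) (𝒫 k (k + n))
  B = map (map suc) (𝒫 (suc k) n)

  disjoint : Disjoint A B
  disjoint (a , b)
    with xs , _ , refl ← ∈-map⁻ (_∷ʳ 1) a
       | ys , q , eq   ← ∈-map⁻ (map suc) b
    = ∷ʳ1≢map-suc xs (_⊢_.positive (proj₁ (∈𝒫⁻ {suc k} {n} q))) eq

  to : ∀ {xs} → xs ∈ 𝒫 (suc k) (suc k + n) → xs ∈ A ++ B
  to {xs} p
    with q , l ← ∈𝒫⁻ {suc k} {suc k + n} p
    with unsnoc-1∨map-suc xs (_⊢_.decreasing q) (_⊢_.positive q) l
  ... | inj₁ (ys , refl) =
    ∈-++⁺ˡ (∈-map⁺ (_∷ʳ 1) (∈𝒫⁺ (∷ʳ1-⊢⁻ q) (suc-injective (trans (sym (length-∷ʳ ys 1)) l))))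
  ... | inj₂ (ys , refl , pos) =
    ∈-++⁺ʳ A (∈-map⁺ (map suc) (∈𝒫⁺
      (map-suc-⊢⁻ pos (subst (λ i → map suc ys ⊢ i + n) (sym l′) q)) l′))
    where
    l′ : length ys ≡ suc k
    l′ = trans (sym (length-map suc ys)) l

  fromˡ : ∀ {xs} → xs ∈ A → xs ∈ 𝒫 (suc k) (suc k + n)
  fromˡ a with ys , p , refl ← ∈-map⁻ (_∷ʳ 1) a with q , l ← ∈𝒫⁻ {k} {k + n} p =
    ∈𝒫⁺ (∷ʳ1-⊢⁺ q) (trans (length-∷ʳ ys 1) (cong suc l))

  fromʳ : ∀ {xs} → xs ∈ B → xs ∈ 𝒫 (suc k) (suc k + n)
  fromʳ b with ys , p , refl ← ∈-map⁻ (map suc) b with q , l ← ∈𝒫⁻ {suc k} {n} p =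
    ∈𝒫⁺ (subst (λ i → map suc ys ⊢ i + n) l (map-suc-⊢⁺ q)) (trans (length-map suc ys) l)

-- Positive parts force length ≤ sum. This provides the zero initial values of the recurrences.
𝒫-small : ∀ {k n} → n < k → 𝒫 k n ≡ []
𝒫-small {k} {n} n<k with 𝒫 k n in eq
... | []     = refl
... | xs ∷ _ with q , refl ← ∈𝒫⁻ {k} {n} {xs} (subst (xs ∈_) (sym eq) (here refl)) =
  contradiction (subst (length xs ≤_) (_⊢_.total q) (length≤sum (_⊢_.positive q))) (<⇒≱ n<k)
  where
  length≤sum : ∀ {ys} → All (0 <_) ys → length ys ≤ sum ys
  length≤sum []       = z≤n
  length≤sum (p ∷ ps) = +-mono-≤ p (length≤sum ps)

-- The second elementary symmetric function under both moves.

σ₂ : List ℕ → ℕ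
σ₂ []       = 0
σ₂ (x ∷ xs) = x * sum xs + σ₂ xs

-- At a concrete length the enumeration of index pairs computes, which leaves a polynomial identity
-- in four variables.
e₂≡σ₂ : ∀ xs → length xs ≡ 4 → e₂ xs ≡ σ₂ xs
e₂≡σ₂ (a ∷ b ∷ c ∷ d ∷ []) refl = expand a b c d
  where
  expand : ∀ a b c d →
           a * b + (a * c + (a * d + (b * c + (b * d + (c * d + 0))))) ≡
           a * (b + (c + (d + 0))) + (b * (c + (d + 0)) + (c * (d + 0) + (d * 0 + 0)))
  expand = solve-∀

σ₂-∷ʳ1 : ∀ xs → σ₂ (xs ∷ʳ 1) ≡ σ₂ xs + sum xs
σ₂-∷ʳ1 []       = refl
σ₂-∷ʳ1 (x ∷ xs) rewrite sum-∷ʳ xs 1 | σ₂-∷ʳ1 xs = regroup x (sum xs) (σ₂ xs)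
  where
  regroup : ∀ x s p → x * suc s + (p + s) ≡ x * s + p + (x + s)
  regroup = solve-∀

suc-C₂ : ∀ n → suc n C 2 ≡ n + n C 2
suc-C₂ n = trans (sym (nCk+nC[k+1]≡[n+1]C[k+1] n 1)) (cong (_+ n C 2) (nC1≡n n))

-- sum xs is added on the left to avoid the coefficient length xs ∸ 1.
σ₂-map-suc : ∀ xs → σ₂ (map suc xs) + sum xs ≡ σ₂ xs + (length xs * sum xs + length xs C 2)
σ₂-map-suc []       = refl
σ₂-map-suc (x ∷ xs) = begin
  suc x * sum (map suc xs) + σ₂ (map suc xs) + (x + sum xs)
    ≡⟨ cong (λ s → suc x * s + σ₂ (map suc xs) + (x + sum xs)) (sum-map-suc xs) ⟩
  suc x * (l + sum xs) + σ₂ (map suc xs) + (x + sum xs)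
    ≡⟨ isolate (suc x * (l + sum xs)) (σ₂ (map suc xs)) x (sum xs) ⟩
  suc x * (l + sum xs) + x + (σ₂ (map suc xs) + sum xs)
    ≡⟨ cong (suc x * (l + sum xs) + x +_) (σ₂-map-suc xs) ⟩
  suc x * (l + sum xs) + x + (σ₂ xs + (l * sum xs + l C 2))
    ≡⟨ regroup x l (sum xs) (σ₂ xs) (l C 2) ⟩
  x * sum xs + σ₂ xs + (suc l * (x + sum xs) + (l + l C 2))
    ≡⟨ cong (λ t → x * sum xs + σ₂ xs + (suc l * (x + sum xs) + t)) (suc-C₂ l) ⟨
  x * sum xs + σ₂ xs + (suc l * (x + sum xs) + suc l C 2)
    ∎
  where
  open ≡-Reasoning
  l = length xs
  isolate : ∀ a b c d → a + b + (c + d) ≡ a + c + (b + d)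
  isolate = solve-∀
  regroup : ∀ x l s p t → suc x * (l + s) + x + (p + (l * s + t)) ≡
                          x * s + p + (suc l * (x + s) + (l + t))
  regroup = solve-∀

-- Recurrences for the counts and the sums of `σ₂`.

count : ℕ → ℕ → ℕ
count k n = length (𝒫 k n)

Σσ₂ : ℕ → ℕ → ℕ
Σσ₂ k n = sum (map σ₂ (𝒫 k n))

e₂p₄≡Σσ₂ : ∀ n → e₂p₄ n ≡ Σσ₂ 4 n
e₂p₄≡Σσ₂ n = cong sum (map-cong-local (All.tabulate
  (λ {xs} p → e₂≡σ₂ xs (proj₂ (∈𝒫⁻ {4} {n} p)))))

count-step : ∀ k n → count (suc k) (suc k + n) ≡ count (suc k) n + count k (k + n)
count-step k n = begin
  count (suc k) (suc k + n)             ≡⟨ ↭-length (𝒫-step k n) ⟩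
  length (A ++ B)                       ≡⟨ length-++ A ⟩
  length A + length B                   ≡⟨ cong₂ _+_ (length-map (_∷ʳ 1) (𝒫 k (k + n))) (length-map (map suc) (𝒫 (suc k) n)) ⟩
  count k (k + n) + count (suc k) n     ≡⟨ +-comm (count k (k + n)) _ ⟩
  count (suc k) n + count k (k + n)     ∎
  where
  open ≡-Reasoning
  A = map (_∷ʳ 1) (𝒫 k (k + n))
  B = map (map suc) (𝒫 (suc k) n)

-- Appending 1 adds the total `k + n`. Since (x+1)(y+1) = xy + x + y + 1 and each of `suc k` parts
-- lies in `k` pairs, raising all parts adds `k * n + suc k C 2`.
Σσ₂-step : ∀ k n → Σσ₂ (suc k) (suc k + n) ≡
  Σσ₂ (suc k) n +
  (Σσ₂ k (k + n) + (k + n) * count k (k + n) + (k * n + suc k C 2) * count (suc k) n)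
Σσ₂-step k n = begin
  Σσ₂ (suc k) (suc k + n)
    ≡⟨ sum-↭ (map⁺ σ₂ (𝒫-step k n)) ⟩
  sum (map σ₂ (map (_∷ʳ 1) P ++ map (map suc) Q))
    ≡⟨ cong sum (map-++ σ₂ (map (_∷ʳ 1) P) (map (map suc) Q)) ⟩
  sum (map σ₂ (map (_∷ʳ 1) P) ++ map σ₂ (map (map suc) Q))
    ≡⟨ sum-++ (map σ₂ (map (_∷ʳ 1) P)) _ ⟩
  sum (map σ₂ (map (_∷ʳ 1) P)) + sum (map σ₂ (map (map suc) Q))
    ≡⟨ cong₂ (λ as bs → sum as + sum bs) (map-∘ P) (map-∘ Q) ⟨
  sum (map (σ₂ ∘ (_∷ʳ 1)) P) + sum (map (σ₂ ∘ map suc) Q)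
    ≡⟨ cong₂ _+_ (sum-map-+ (All.tabulate onP)) (sum-map-+ (All.tabulate onQ)) ⟩
  (Σσ₂ k (k + n) + (k + n) * count k (k + n)) +
  (Σσ₂ (suc k) n + (k * n + suc k C 2) * count (suc k) n)
    ≡⟨ regroup (Σσ₂ k (k + n)) ((k + n) * count k (k + n)) (Σσ₂ (suc k) n) _ ⟩
  Σσ₂ (suc k) n +
  (Σσ₂ k (k + n) + (k + n) * count k (k + n) + (k * n + suc k C 2) * count (suc k) n)
    ∎
  where
  open ≡-Reasoning
  P = 𝒫 k (k + n)
  Q = 𝒫 (suc k) n

  onP : ∀ {xs} → xs ∈ P → σ₂ (xs ∷ʳ 1) ≡ σ₂ xs + (k + n)
  onP {xs} p with q , _ ← ∈𝒫⁻ {k} {k + n} p =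
    trans (σ₂-∷ʳ1 xs) (cong (σ₂ xs +_) (_⊢_.total q))

  onQ : ∀ {xs} → xs ∈ Q → σ₂ (map suc xs) ≡ σ₂ xs + (k * n + suc k C 2)
  -- Adding `n`, the sum of `xs`, to both sides matches the subtraction-free form of `σ₂-map-suc`.
  onQ {xs} p with q , l ← ∈𝒫⁻ {suc k} {n} p = +-cancelʳ-≡ n _ _ (begin
    σ₂ (map suc xs) + n                        ≡⟨ cong (σ₂ (map suc xs) +_) (_⊢_.total q) ⟨
    σ₂ (map suc xs) + sum xs                   ≡⟨ σ₂-map-suc xs ⟩
    σ₂ xs + (length xs * sum xs + length xs C 2)
      ≡⟨ cong₂ (λ i s → σ₂ xs + (i * s + i C 2)) l (_⊢_.total q) ⟩
    σ₂ xs + (suc k * n + suc k C 2)            ≡⟨ pull (σ₂ xs) k n (suc k C 2) ⟩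
    σ₂ xs + (k * n + suc k C 2) + n            ∎)
    where
    pull : ∀ p k n t → p + (suc k * n + t) ≡ p + (k * n + t) + n
    pull = solve-∀

  regroup : ∀ a b c d → (a + b) + (c + d) ≡ c + (a + b + d)
  regroup = solve-∀

-- Solving the recurrence with step `k`.

-- The solution of u (k + n) ≡ u n + g n with u 0, …, u (k ∸ 1) ≡ 0, in closed
-- form so that it can be evaluated.
solution : (k : ℕ) .{{_ : NonZero k}} → (ℕ → ℕ) → ℕ → ℕ
solution k g n = sum (applyUpTo (λ t → g (n % k + t * k)) (n / k))

solution-small : ∀ k .{{_ : NonZero k}} g {n} → n < k → solution k g n ≡ 0
solution-small k g {n} n<k rewrite m<n⇒m/n≡0 {n} {k} n<k = refl

-- Raising `n` by `k` keeps the remainder and appends one term to the sum; by division with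
-- remainder that term is `g n`.
solution-step : ∀ k .{{_ : NonZero k}} g n → solution k g (k + n) ≡ solution k g n + g n
solution-step k g n = begin
  sum (applyUpTo (λ t → g ((k + n) % k + t * k)) ((k + n) / k))
    ≡⟨ cong₂ (λ r q → sum (applyUpTo (λ t → g (r + t * k)) q)) rem quot ⟩
  sum (applyUpTo h (suc (n / k)))
    ≡⟨ cong sum (applyUpTo-∷ʳ h (n / k)) ⟨
  sum (applyUpTo h (n / k) ∷ʳ h (n / k))
    ≡⟨ sum-∷ʳ (applyUpTo h (n / k)) _ ⟩
  h (n / k) + solution k g n
    ≡⟨ cong (λ i → g i + solution k g n) (m≡m%n+[m/n]*n n k) ⟨
  g n + solution k g n
    ≡⟨ +-comm (g n) _ ⟩
  solution k g n + g n
    ∎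
  where
  open ≡-Reasoning
  h : ℕ → ℕ
  h t = g (n % k + t * k)
  rem : (k + n) % k ≡ n % k
  rem = trans (cong (_% k) (+-comm k n)) ([m+n]%n≡m%n n k)
  quot : (k + n) / k ≡ suc (n / k)
  quot = trans (+-distrib-/-∣ˡ n ∣-refl) (cong (_+ n / k) (n/n≡1 k))

step-rec : ∀ k .{{_ : NonZero k}} {P : ℕ → Set} →
           (∀ {n} → n < k → P n) → (∀ n → P n → P (k + n)) → ∀ n → P n
step-rec k {P} base step = <-rec P λ n rec → case n rec
  where
  case : ∀ n → (∀ {m} → m < n → P m) → P n
  case n rec with n <? k
  ... | yes n<k = base n<k
  ... | no  n≮k = subst P (m+[n∸m]≡n k≤n) (step (n ∸ k) (rec (∸-monoʳ-< (>-nonZero⁻¹ k) k≤n)))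
    where k≤n = ≮⇒≥ n≮k

solution-unique : ∀ k .{{_ : NonZero k}} {g u : ℕ → ℕ} →
                  (∀ {n} → n < k → u n ≡ 0) →
                  (∀ n → u (k + n) ≡ u n + g n) →
                  ∀ n → u n ≡ solution k g n
solution-unique k {g} {u} base step = step-rec k
  (λ n<k → trans (base n<k) (sym (solution-small k g n<k)))
  (λ n eq → trans (step n) (trans (cong (_+ g n) eq) (sym (solution-step k g n))))

-- Evaluable forms of count (suc k) and Σσ₂ (suc k); starting from one part keeps
-- the evaluation in Returns below affordable.
c : ℕ → ℕ → ℕ
c zero    zero    = 0
c zero    (suc n) = 1
c (suc k)         = solution (2 + k) (λ n → c k (suc k + n))

e : ℕ → ℕ → ℕ
e-step : ℕ → ℕ → ℕ
e zero    n = 0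
e (suc k) n = solution (2 + k) (e-step k) n
e-step k n = e k (suc k + n) + (suc k + n) * c k (suc k + n) + (suc k * n + (2 + k) C 2) * c (suc k) n

count≡c : ∀ k n → count (suc k) n ≡ c k n
count≡c zero    zero          = refl
count≡c zero    (suc zero)    = refl
-- `count 0 (suc n)` computes to 0. The empty partition of 0 contributes only to the step from 0 to
-- 1, hence the separate case 1.
count≡c zero    (suc (suc n)) = trans (count-step 0 (suc n)) (trans (+-identityʳ _) (count≡c zero (suc n)))
count≡c (suc k)               = solution-unique (2 + k)
  (λ n<k → cong length (𝒫-small n<k))
  (λ n → trans (count-step (suc k) n) (cong (count (2 + k) n +_) (count≡c k (suc k + n))))

Σσ₂≡e : ∀ k n → Σσ₂ (suc k) n ≡ e k n
Σσ₂≡e zero    zero    = refl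
Σσ₂≡e zero    (suc n) = trans (Σσ₂-step 0 n) (cong₂ _+_ (Σσ₂≡e zero n) (source≡0 n))
  where
  -- Either `n` is 0 or there is no partition of `n` into zero parts.
  source≡0 : ∀ n → Σσ₂ 0 n + n * count 0 n + 0 ≡ 0
  source≡0 zero    = refl
  source≡0 (suc n) = cong (_+ 0) (*-zeroʳ n)
Σσ₂≡e (suc k)         = solution-unique (2 + k)
  (λ n<k → cong (sum ∘ map σ₂) (𝒫-small n<k))
  (λ n → trans (Σσ₂-step (suc k) n) (cong (Σσ₂ (2 + k) n +_)
    (cong₂ _+_ (cong₂ _+_ (Σσ₂≡e k (suc k + n)) (cong ((suc k + n) *_) (count≡c k (suc k + n))))
               (cong ((suc k * n + (2 + k) C 2) *_) (count≡c (suc k) n)))))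

-- Periodicity modulo `m`.

module Periods (m T : ℕ) .{{_ : NonZero m}} where

  infix 4 _≈_
  _≈_ : ℕ → ℕ → Set
  a ≈ b = a % m ≡ b % m

  +-cong : ∀ {a b c d} → a ≈ b → c ≈ d → a + c ≈ b + d
  +-cong {a} {b} {c} {d} p q = trans (%-distribˡ-+ a c m)
    (trans (cong₂ (λ x y → (x + y) % m) p q) (sym (%-distribˡ-+ b d m)))

  *-cong : ∀ {a b c d} → a ≈ b → c ≈ d → a * c ≈ b * d
  *-cong {a} {b} {c} {d} p q = trans (%-distribˡ-* a c m)
    (trans (cong₂ (λ x y → (x * y) % m) p q) (sym (%-distribˡ-* b d m)))

  Periodic : (ℕ → ℕ) → Set
  Periodic u = ∀ n → u (n + T) ≈ u n

  shift : ∀ k u → Periodic u → Periodic (λ n → u (k + n))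
  shift k u p n = trans (cong (λ i → u i % m) (sym (+-assoc k n T))) (p (k + n))

  -- A solution of the recurrence vanishes at i < k, so it is T-periodic as
  -- soon as the source term is and the solution vanishes at T + i as well.
  Returns : (k : ℕ) .{{_ : NonZero k}} → (ℕ → ℕ) → Set
  Returns k u = True (allUpTo? (λ i → u (i + T) % m ≟ 0 % m) k)

  solution-periodic : ∀ k .{{_ : NonZero k}} g → Periodic g →
                      Returns k (solution k g) → Periodic (solution k g)
  solution-periodic k g p r = step-rec k
    (λ i<k → trans (toWitness r i<k) (cong (_% m) (sym (solution-small k g i<k))))
    (λ n ih → trans (cong (λ i → solution k g i % m) (+-assoc k n T))
      (trans (cong (_% m) (solution-step k g (n + T)))
      (trans (+-cong ih (p n)) (cong (_% m) (sym (solution-step k g n))))))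

  module _ (m∣T : T % m ≡ 0 % m) (c₂↩ : Returns 2 (c 1)) (c₃↩ : Returns 3 (c 2)) where

    id-periodic : Periodic (λ n → n)
    id-periodic n = trans (+-cong {n} refl m∣T) (cong (_% m) (+-identityʳ n))

    -- As `m` divides `T`, the linear coefficient is itself `T`-periodic.
    weighted : ∀ k l u → Periodic u → Periodic (λ n → (k * n + l) * u n)
    weighted k l u p n = *-cong (+-cong {c = l} (*-cong {k} refl (id-periodic n)) refl) (p n)

    c₂-periodic : Periodic (c 1)
    -- `c 0` jumps from 0 to 1 at the start; only its shift is constant.
    c₂-periodic = solution-periodic 2 (λ n → c 0 (1 + n)) (λ _ → refl) c₂↩

    c₃-periodic : Periodic (c 2)
    c₃-periodic = solution-periodic 3 (λ n → c 1 (2 + n)) (shift 2 (c 1) c₂-periodic) c₃↩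

    e-step-periodic : ∀ k → Periodic (λ n → e k (suc k + n)) → Periodic (λ n → c k (suc k + n)) →
                      Periodic (λ n → (suc k * n + (2 + k) C 2) * c (suc k) n) →
                      Periodic (e-step k)
    e-step-periodic k pe pc pc′ n =
      +-cong (+-cong (pe n) (*-cong (shift (suc k) (λ i → i) id-periodic n) (pc n))) (pc′ n)

    -- Climbs from two parts to four, each source term using the level below. The last product is a
    -- hypothesis so that modulus 3 can supply it without periodicity of `c 3`.
    e₂p₄-periodic : Returns 2 (e 1) → Returns 3 (e 2) → Returns 4 (e 3) →
                  Periodic (λ n → (3 * n + 6) * c 3 n) → Periodic e₂p₄
    e₂p₄-periodic e₂↩ e₃↩ e₄↩ p n = begin
      e₂p₄ (n + T) % m  ≡⟨ cong (_% m) (e₂p₄≡e (n + T)) ⟩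
      e 3 (n + T) % m   ≡⟨ p₄ n ⟩
      e 3 n % m         ≡⟨ cong (_% m) (e₂p₄≡e n) ⟨
      e₂p₄ n % m        ∎
      where
      open ≡-Reasoning
      e₂p₄≡e : ∀ n → e₂p₄ n ≡ e 3 n
      e₂p₄≡e n = trans (e₂p₄≡Σσ₂ n) (Σσ₂≡e 3 n)
      p₂ : Periodic (e 1)
      p₂ = solution-periodic 2 (e-step 0)
        -- The numerals `1 1`, and `2 3` for three parts, are the values of `suc k` and
        -- `(2 + k) C 2`.
        (e-step-periodic 0 (λ _ → refl) (λ _ → refl) (weighted 1 1 (c 1) c₂-periodic)) e₂↩
      p₃ : Periodic (e 2)
      p₃ = solution-periodic 3 (e-step 1)
        (e-step-periodic 1 (shift 2 (e 1) p₂) (shift 2 (c 1) c₂-periodic) (weighted 2 3 (c 2) c₃-periodic)) e₃↩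
      p₄ : Periodic (e 3)
      p₄ = solution-periodic 4 (e-step 2)
        (e-step-periodic 2 (shift 3 (e 2) p₃) (shift 3 (c 2) c₃-periodic) p) e₄↩

    c₄-weighted : Returns 4 (c 3) → Periodic (λ n → (3 * n + 6) * c 3 n)
    c₄-weighted c₄↩ = weighted 3 6 (c 3)
      (solution-periodic 4 (λ n → c 2 (3 + n)) (shift 3 (c 2) c₃-periodic) c₄↩)

-- The moduli 2, 3 and 4.

c₄-weighted-mod-3 : ∀ n → (3 * n + 6) * c 3 n % 3 ≡ 0
c₄-weighted-mod-3 n = trans (cong (_% 3) (factor n (c 3 n))) (m*n%n≡0 ((n + 2) * c 3 n) 3)
  where
  factor : ∀ n x → (3 * n + 6) * x ≡ (n + 2) * x * 3
  factor = solve-∀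

theorem2 : (n : ℕ) →
    (e₂p₄ (n + 48) % 2 ≡ e₂p₄ n % 2) ×
    (e₂p₄ (n + 54) % 3 ≡ e₂p₄ n % 3) ×
    (e₂p₄ (n + 96) % 4 ≡ e₂p₄ n % 4)
theorem2 n =
  -- Each underscore stands for a `Returns` check, whose type evaluates to the unit type; `refl`
  -- checks that the modulus divides the period.
  Mod2.e₂p₄-periodic refl _ _ _ _ _ (Mod2.c₄-weighted refl _ _ _) n ,
  Mod3.e₂p₄-periodic refl _ _ _ _ _
    (λ i → trans (c₄-weighted-mod-3 (i + 54)) (sym (c₄-weighted-mod-3 i))) n ,
  Mod4.e₂p₄-periodic refl _ _ _ _ _ (Mod4.c₄-weighted refl _ _ _) n
  where
  module Mod2 = Periods 2 48
  module Mod3 = Periods 3 54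
  module Mod4 = Periods 4 96
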